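{- The decision problem ITP (given a multipartite graph $G$ together with its partition into parts, decide whether $G$ has an interconnection tree) can be solved in time $O(n)$ when restricted to complete multipartite graphs with $n$ vertices.
   Context: Graphs are finite, simple and undirected. A multipartite graph $G=(V=V_1\sqcup\dots\sqcup V_k,E)$ is a graph whose vertex set is partitioned into $k$ non-empty parts $V_1,\dots,V_k$, each of which is an independent set. It is always given together with the function $\mathrm{Part}:V\to[k]=\{1,\dots,k\}$, where $\mathrm{Part}(v)=i$ iff $v\in V_i$. It is complete multipartite if for all $i\ne j$, all $u\in V_i$ and $v\in V_j$, $(u,v)\in E$. For an edge, $\mathrm{Part}((u,v))=(\mathrm{Part}(u),\mathrm{Part}(v))$, and for a set $F$ of edges, $\mathrm{Part}(F)=\{\mathrm{Part}(e)\mid e\in F\}$. The quotient graph of $G$ is $G_{\mathrm{Part}}=([k],\mathrm{Part}(E))$. An interconnection tree of $G$ is a set $T\subseteq E$ such that (1) $T$ is a matching in $G$, and (2) $\mathrm{Part}(T)$ is a spanning tree of $G_{\mathrm{Part}}$, distinct edges of $T$ having distinct projections (so that $|T|=k-1$). -}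

module Defs where

open import Data.Bool.Base using (Bool; true; false; if_then_else_)
open import Data.Fin.Base using (Fin; toℕ)
open import Data.List.Base using (List; []; _∷_; _++_; _∷ʳ_; length; head; drop; map; allFin; cartesianProductWith)
open import Data.List.Relation.Unary.Linked using (Linked)
open import Data.List.Relation.Unary.Unique.Propositional using (Unique)
open import Data.Maybe.Base using (Maybe; just; nothing; fromMaybe)
open import Data.Nat.Base using (ℕ; zero; suc; _+_; _*_; _∸_; _^_; _≤_; _<ᵇ_; _≡ᵇ_)
open import Data.Nat.DivMod using (_%_)
open import Data.Nat.Properties using (m^n≢0)
open import Data.Product.Base using (Σ; ∃; _×_; _,_)
open import Level using (0ℓ)
open import Relation.Binary.Construct.Closure.ReflexiveTransitive using (Star)
open import Relation.Binary.Core using (Rel; _⇒_)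
open import Relation.Binary.Definitions using (Decidable; Symmetric)
open import Relation.Binary.PropositionalEquality.Core using (_≡_; _≢_; refl)
open import Relation.Nullary.Decidable.Core using (does)
open import Relation.Nullary.Negation.Core using (¬_)
open import Relation.Nullary.Reflects using (Reflects)

------------------------------------------------------------------------
-- Graphs and trees

record Graph (V : Set) : Set₁ where
  field
    Adj      : Rel V 0ℓ
    adj-sym  : Symmetric Adj
    adj-irr  : ∀ {v} → ¬ Adj v v

Connected : {V : Set} → Rel V 0ℓ → Set
Connected {V} E = (u v : V) → Star E u v

-- The vertices v ∷ vs in cyclic order; there must be at least three.
record Cycle {V : Set} (E : Rel V 0ℓ) : Set where
  field
    v        : V
    vs       : List V
    long     : 2 ≤ length vs
    distinct : Unique (v ∷ vs)
    closed   : Linked E (v ∷ (vs ∷ʳ v))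

Acyclic : {V : Set} → Rel V 0ℓ → Set
Acyclic E = ¬ Cycle E

-- A set of undirected edges is a symmetric relation.
record IsSpanningTree {V : Set} (H : Graph V) (F : Rel V 0ℓ) : Set where
  open Graph H
  field
    subset    : F ⇒ Adj
    symmetric : Symmetric F
    connected : Connected F
    acyclic   : Acyclic F

IsMatching : {V : Set} → Rel V 0ℓ → Set
IsMatching T = ∀ {u v w} → T u v → T u w → v ≡ w

------------------------------------------------------------------------
-- Multipartite graphs

record MultipartiteGraph (n k : ℕ) : Set₁ where
  field
    graph       : Graph (Fin n)
  open Graph graph public
  field
    adj?        : Decidable Adj
    part        : Fin n → Fin k
    k≥1         : 1 ≤ k
    nonEmpty    : ∀ i → ∃ λ v → part v ≡ i
    independent : ∀ {u v} → Adj u v → part u ≢ part v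

  -- Part(F), for a set F of edges.
  data Image (F : Rel (Fin n) 0ℓ) : Rel (Fin k) 0ℓ where
    image : ∀ {u v} → F u v → Image F (part u) (part v)

  image-sym : ∀ {F} → Symmetric F → Symmetric (Image F)
  image-sym s (image e) = image (s e)

  private
    image-irr : ∀ {i j} → Image Adj i j → i ≢ j
    image-irr (image e) = independent e

  quotient : Graph (Fin k)
  quotient = record
    { Adj     = Image Adj
    ; adj-sym = image-sym adj-sym
    ; adj-irr = λ e → image-irr e refl
    }

IsComplete : ∀ {n k} → MultipartiteGraph n k → Set
IsComplete G = ∀ u v → part u ≢ part v → Adj u v
  where open MultipartiteGraph G

record InterconnectionTree {n k} (G : MultipartiteGraph n k) : Set₁ where
  open MultipartiteGraph G
  field
    T            : Rel (Fin n) 0ℓ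
    T?           : Decidable T
    T-sym        : Symmetric T
    T⊆E          : T ⇒ Adj
    matching     : IsMatching T
    spanningTree : IsSpanningTree quotient (Image T)
    -- By symmetry of T this also covers projections that agree after
    -- reversing one of the two edges.
    injective    : ∀ {u v u′ v′} → T u v → T u′ v′ →
                   part u ≡ part u′ → part v ≡ part v′ → u ≡ u′ × v ≡ v′

------------------------------------------------------------------------
-- Word RAM

Reg Label : Set
Reg   = ℕ
Label = ℕ

data Instr : Set where
  const         : Reg → ℕ → Instr            -- r := c
  add sub       : Reg → Reg → Reg → Instr    -- r := s ± t  (mod 2^w)
  load          : Reg → Reg → Instr          -- r := mem[s]
  store         : Reg → Reg → Instr          -- mem[r] := s
  jlt           : Reg → Reg → Label → Instr  -- if r < s goto l
  accept reject : Instr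

Program : Set
Program = List Instr

_‼_ : {A : Set} → List A → ℕ → Maybe A
xs ‼ i = head (drop i xs)

_[_↦_] : (ℕ → ℕ) → ℕ → ℕ → (ℕ → ℕ)
(f [ i ↦ x ]) j = if j ≡ᵇ i then x else f j

record State : Set where
  constructor ⟨_,_,_⟩
  field
    pc   : Label
    regs : ℕ → ℕ
    mem  : ℕ → ℕ

-- Registers start at 0, as do the memory words beyond the input.
initial : List ℕ → State
initial xs = ⟨ 0 , (λ _ → 0) , (λ a → fromMaybe 0 (xs ‼ a)) ⟩

module _ (w : ℕ) where

  wrap : ℕ → ℕ
  wrap x = _%_ x (2 ^ w) {{m^n≢0 2 w}}

  -- The answer if p halts within the given number of steps, each
  -- instruction being one step.  A jump outside p never yields an answer.
  run : Program → ℕ → State → Maybe Bool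
  exec : Program → ℕ → Maybe Instr → State → Maybe Bool

  run p zero    s = nothing
  run p (suc t) s = exec p t (p ‼ State.pc s) s

  exec p t nothing s = nothing
  exec p t (just accept) s = just true
  exec p t (just reject) s = just false
  exec p t (just (const r c)) ⟨ pc , R , M ⟩ =
    run p t ⟨ suc pc , R [ r ↦ wrap c ] , M ⟩
  exec p t (just (add r a b)) ⟨ pc , R , M ⟩ =
    run p t ⟨ suc pc , R [ r ↦ wrap (R a + R b) ] , M ⟩
  exec p t (just (sub r a b)) ⟨ pc , R , M ⟩ =
    run p t ⟨ suc pc , R [ r ↦ wrap (R a + (2 ^ w ∸ R b)) ] , M ⟩
  exec p t (just (load r a)) ⟨ pc , R , M ⟩ =
    run p t ⟨ suc pc , R [ r ↦ M (R a) ] , M ⟩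
  exec p t (just (store r a)) ⟨ pc , R , M ⟩ =
    run p t ⟨ suc pc , R , M [ R r ↦ R a ] ⟩
  exec p t (just (jlt r a l)) ⟨ pc , R , M ⟩ =
    run p t ⟨ (if R r <ᵇ R a then l else suc pc) , R , M ⟩

------------------------------------------------------------------------
-- Decision problems on partitioned multipartite graphs

-- n, then Part(0), …, Part(n-1), then the adjacency matrix row by row.
-- k is not given separately.
encode : ∀ {n k} → MultipartiteGraph n k → List ℕ
encode {n} G =
  n ∷ map (λ v → toℕ (part v)) (allFin n)
    ++ cartesianProductWith bit (allFin n) (allFin n)
  where
  open MultipartiteGraph G
  bit : Fin n → Fin n → ℕ
  bit u v = if does (adj? u v) then 1 else 0

Problem : Set₂
Problem = ∀ {n k} → MultipartiteGraph n k → Set₁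

GraphClass : Set₁
GraphClass = ∀ {n k} → MultipartiteGraph n k → Set

ITP : Problem
ITP = InterconnectionTree

-- One program and one constant serve all inputs in the class and all word
-- sizes w for which the input can be addressed; its entries then fit in a
-- word too, as n and the values of Part are less than the input length.
-- Nothing is required on inputs outside the class.  Time is a function of
-- the number n of vertices; since n ≥ 1 always, the bound c * f n needs no
-- threshold on n.
SolvableInTimeO : (ℕ → ℕ) → Problem → GraphClass → Set₁
SolvableInTimeO f Π 𝒞 =
  Σ Program λ p → Σ ℕ λ c →
  ∀ {n k} (G : MultipartiteGraph n k) → 𝒞 G →
  ∀ w → length (encode G) ≤ 2 ^ w →
  Σ Bool λ answer →
    run w p (c * f n) (initial (encode G)) ≡ just answer × Reflects (Π G) answer

{-# OPTIONS --safe #-}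
module Submission where

-- A complete multipartite graph with k parts and n vertices has an
-- interconnection tree iff 2(k - 1) ≤ n.  The matching needs 2(k - 1) distinct
-- endpoints.  Conversely, grow the tree by joining one new part at a time to a
-- free vertex of the old parts, parts with several vertices first; a free
-- vertex is missing only if all remaining parts are singletons and n is too
-- small.  Linear time suffices to compute k from Part and compare.

open import Data.Bool.Base using (Bool; true; false; not)
open import Data.Fin.Base as Fin using (Fin; toℕ; fromℕ<)
open import Data.Fin.Properties as Fin using (any?; injective⇒≤; toℕ<n; toℕ-fromℕ<; toℕ-injective)
open import Data.List.Base using (List; []; _∷_; _++_; _∷ʳ_; length; map; allFin; filter; lookup; tabulate; cartesianProductWith)
open import Data.List.Membership.Propositional using (_∈_; _∉_)
open import Data.List.Membership.Propositional.Properties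
  using (∈-lookup; ∈-allFin; ∈-++⁺ˡ; ∈-++⁺ʳ; ∈-filter⁺; ∈-filter⁻; ∈-map⁻)
open import Data.List.Membership.Setoid.Properties using (index-injective)
open import Data.List.Properties using (length-++; length-map; length-tabulate; map-tabulate)
open import Data.List.Relation.Binary.Subset.Propositional using (_⊆_)
open import Data.List.Relation.Unary.All as All using (All; []; _∷_)
open import Data.List.Relation.Unary.All.Properties using (¬Any⇒All¬; map⁺)
open import Data.List.Relation.Unary.AllPairs using ([]; _∷_)
open import Data.List.Relation.Unary.Any as Any using (here; there)
open import Data.List.Relation.Unary.Linked using (Linked; _∷_)
open import Data.List.Relation.Unary.Unique.Propositional using (Unique)
open import Data.List.Relation.Unary.Unique.Propositional.Properties as Unique using (allFin⁺; Unique[x∷xs]⇒x∉xs)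
open import Data.Maybe.Base using (just; fromMaybe)
open import Data.Nat.Base
open import Data.Nat.DivMod using (m<n⇒m%n≡m)
open import Data.Nat.Properties
open import Data.Product.Base using (∃; ∃₂; _×_; _,_; proj₁; proj₂; uncurry)
open import Data.Sum.Base as Sum using (_⊎_; inj₁; inj₂)
open import Function.Base using (_∘_; id)
open import Level using (0ℓ)
open import Relation.Binary.Construct.Closure.ReflexiveTransitive as Star using (Star; ε; _◅_; _◅◅_)
open import Relation.Binary.Core using (Rel)
open import Relation.Binary.Definitions using (Decidable)
open import Relation.Binary.PropositionalEquality
  using (_≡_; _≢_; refl; sym; trans; cong; cong₂; subst; setoid)
open import Relation.Nullary.Decidable using (Dec; yes; no; map′; _×-dec_; ¬?; decidable-stable; dec-true; dec-false)
open import Relation.Nullary.Negation.Core using (contradiction)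
open import Relation.Nullary.Reflects using (Reflects; ofʸ; ofⁿ)

open import Defs

-- Counting with lists without repetition

lookup-injective : {A : Set} {xs : List A} → Unique xs →
                   ∀ {i j} → lookup xs i ≡ lookup xs j → i ≡ j
lookup-injective (x∉ ∷ u) {Fin.zero}  {Fin.zero}  eq = refl
lookup-injective (x∉ ∷ u) {Fin.zero}  {Fin.suc j} eq = contradiction eq (All.lookup x∉ (∈-lookup j))
lookup-injective (x∉ ∷ u) {Fin.suc i} {Fin.zero}  eq = contradiction (sym eq) (All.lookup x∉ (∈-lookup i))
lookup-injective (x∉ ∷ u) {Fin.suc i} {Fin.suc j} eq = cong Fin.suc (lookup-injective u eq)

-- Sending a position of `xs` to the position of its entry in `ys` is injective: equal positions in
-- `ys` carry equal entries, and these do not repeat in `xs`.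
unique-⊆⇒length≤ : {A : Set} {xs ys : List A} → Unique xs → xs ⊆ ys → length xs ≤ length ys
unique-⊆⇒length≤ {A} u xs⊆ys = injective⇒≤ {f = λ i → Any.index (xs⊆ys (∈-lookup i))}
  (lookup-injective u ∘ index-injective (setoid A) _ _)

module _ {n : ℕ} where

  open import Data.List.Membership.DecPropositional (Fin._≟_ {n}) public using (_∈?_)

  length-allFin : length (allFin n) ≡ n
  length-allFin = length-tabulate id

  unique⇒length≤ : {xs : List (Fin n)} → Unique xs → length xs ≤ n
  unique⇒length≤ {xs} u = begin
    length xs         ≤⟨ unique-⊆⇒length≤ u (λ _ → ∈-allFin _) ⟩
    length (allFin n) ≡⟨ length-allFin ⟩
    n                 ∎
    where open ≤-Reasoning

  exhaustive⇒≤length : {xs : List (Fin n)} → (∀ i → i ∈ xs) → n ≤ length xs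
  exhaustive⇒≤length {xs} all∈ = begin
    n                 ≡⟨ length-allFin ⟨
    length (allFin n) ≤⟨ unique-⊆⇒length≤ (allFin⁺ n) (λ _ → all∈ _) ⟩
    length xs         ∎
    where open ≤-Reasoning

  ∃-outside : (xs : List (Fin n)) → length xs < n → ∃ λ i → i ∉ xs
  ∃-outside xs short with any? (λ i → ¬? (i ∈? xs))
  ... | yes found = found
  ... | no  none  = contradiction
    (exhaustive⇒≤length (λ i → decidable-stable (i ∈? xs) (λ i∉ → none (i , i∉))))
    (<⇒≱ short)

-- Acyclicity of rooted forests

-- A walk that never backtracks in a forest oriented away from its roots
-- keeps climbing once it has started to climb.  Hence a cycle descends all
-- along, unless it arrives at its start from the parent; neither is possible.
module Rooted {V : Set} {E Up : Rel V 0ℓ} (rank : V → ℕ)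
  (orient    : ∀ {i j} → E i j → Up i j ⊎ Up j i)
  (up-rank   : ∀ {i j} → Up i j → rank i < rank j)
  (up-unique : ∀ {i j x} → Up i x → Up j x → i ≡ j)
  where

  -- Here `z` is the vertex at which the cycle closes. A step down from `b` would lead to its only
  -- parent `a`, which distinctness forbids, so every further step goes up and the last one enters
  -- `z` from its parent.
  ascend : ∀ {a b z} ys → Unique (a ∷ b ∷ ys) → All (_≢ z) (a ∷ b ∷ ys) →
           Up a b → Linked E (b ∷ (ys ∷ʳ z)) →
           rank a < rank z × ∃ λ l → l ∈ b ∷ ys × Up l z
  ascend [] _ (a≢z ∷ _) ab (bz ∷ _) with orient bz
  ... | inj₁ up   = <-trans (up-rank ab) (up-rank up) , _ , here refl , up
  ... | inj₂ down = contradiction (up-unique ab down) a≢z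
  ascend (y ∷ ys) ((_ ∷ a≢y ∷ _) ∷ u) (_ ∷ ≢z) ab (by ∷ link) with orient by
  ... | inj₂ down = contradiction (up-unique ab down) a≢y
  ... | inj₁ up with ascend ys u ≢z up link
  ...   | b<z , l , l∈ , lz = <-trans (up-rank ab) b<z , l , there l∈ , lz

  -- The walk either goes down all the way to `z` or turns upwards at some vertex, from where
  -- `ascend` takes over.
  descend : ∀ {a b z} ys → Unique (a ∷ b ∷ ys) → All (_≢ z) (a ∷ b ∷ ys) →
            Up b a → Linked E (b ∷ (ys ∷ʳ z)) →
            rank z < rank a ⊎ ∃ λ l → l ∈ b ∷ ys × Up l z
  descend [] _ _ ba (bz ∷ _) with orient bz
  ... | inj₁ up   = inj₂ (_ , here refl , up)
  ... | inj₂ down = inj₁ (<-trans (up-rank down) (up-rank ba))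
  descend (y ∷ ys) (_ ∷ u) (_ ∷ ≢z) ba (by ∷ link) with orient by
  ... | inj₁ up with ascend ys u ≢z up link
  ...   | _ , l , l∈ , lz = inj₂ (l , there l∈ , lz)
  descend (y ∷ ys) (_ ∷ u) (_ ∷ ≢z) ba (by ∷ link) | inj₂ down
    with descend ys u ≢z down link
  ... | inj₁ z<b           = inj₁ (<-trans z<b (up-rank ba))
  ... | inj₂ (l , l∈ , lz) = inj₂ (l , there l∈ , lz)

  acyclic : Acyclic E
  acyclic record { vs = [] ; long = () }
  acyclic record { vs = _ ∷ [] ; long = s≤s () }
  acyclic record { v = v ; vs = v₁ ∷ v₂ ∷ ys
                 ; distinct = v≢@(_ ∷ v≢v₂ ∷ _) ∷ u ; closed = vv₁ ∷ v₁v₂ ∷ link }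
    with ≢v ← All.map (λ v≢x x≡v → v≢x (sym x≡v)) v≢
    with orient vv₁ | orient v₁v₂
  ... | inj₁ up   | inj₁ up₂   = <-asym (up-rank up) (proj₁ (ascend ys u ≢v up₂ link))
  ... | inj₁ up   | inj₂ down₂ = v≢v₂ (up-unique up down₂)
  ... | inj₂ down | inj₁ up₂ with ascend ys u ≢v up₂ link
  -- The parent of `v` is `v₁`, so the later vertex `l` that is also a parent of `v` would repeat
  -- `v₁`.
  ...   | _ , l , l∈ , lv = Unique[x∷xs]⇒x∉xs u (subst (_∈ v₂ ∷ ys) (up-unique lv down) l∈)
  acyclic record { v = v ; vs = v₁ ∷ v₂ ∷ ys
                 ; distinct = v≢ ∷ u ; closed = vv₁ ∷ v₁v₂ ∷ link }
      | inj₂ down | inj₂ down₂ with descend ys u ≢v down₂ link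
  ... | inj₁ v<v₁          = <-asym v<v₁ (up-rank down)
  ... | inj₂ (l , l∈ , lv) = Unique[x∷xs]⇒x∉xs u (subst (_∈ v₂ ∷ ys) (up-unique lv down) l∈)

-- Lists of directed edges and their symmetric closure

Edges : ℕ → Set
Edges n = List (Fin n × Fin n)

endpoints : ∀ {n} → Edges n → List (Fin n)
endpoints []             = []
endpoints ((u , v) ∷ es) = u ∷ v ∷ endpoints es

length-endpoints : ∀ {n} (es : Edges n) → length (endpoints es) ≡ length es + length es
length-endpoints []       = refl
length-endpoints (e ∷ es) =
  cong suc (trans (cong suc (length-endpoints es)) (sym (+-suc (length es) (length es))))

-- The listed pairs keep a direction because it will orient the tree; this relation forgets it.
data Edge {n} : Edges n → Rel (Fin n) 0ℓ where
  forth : ∀ {u v es} → Edge ((u , v) ∷ es) u v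
  back  : ∀ {u v es} → Edge ((u , v) ∷ es) v u
  old   : ∀ {e es x y} → Edge es x y → Edge (e ∷ es) x y

module _ {n : ℕ} where

  edge? : (es : Edges n) → Decidable (Edge es)
  edge? [] x y = no λ ()
  edge? ((u , v) ∷ es) x y with x Fin.≟ u ×-dec y Fin.≟ v
  ... | yes (refl , refl) = yes forth
  ... | no ≢uv with x Fin.≟ v ×-dec y Fin.≟ u
  ...   | yes (refl , refl) = yes back
  ...   | no ≢vu = map′ old (λ { forth   → contradiction (refl , refl) ≢uv
                               ; back    → contradiction (refl , refl) ≢vu
                               ; (old e) → e }) (edge? es x y)

  edge-sym : ∀ {es : Edges n} {x y} → Edge es x y → Edge es y x
  edge-sym forth   = back
  edge-sym back    = forth
  edge-sym (old e) = old (edge-sym e)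

  edge-source : ∀ {es : Edges n} {x y} → Edge es x y → x ∈ endpoints es
  edge-source forth   = here refl
  edge-source back    = there (here refl)
  edge-source (old e) = there (there (edge-source e))

  endpoint-edge : ∀ (es : Edges n) {x} → x ∈ endpoints es → ∃ λ y → Edge es x y
  endpoint-edge ((u , v) ∷ es) (here refl)         = v , forth
  endpoint-edge ((u , v) ∷ es) (there (here refl)) = u , back
  endpoint-edge (e ∷ es)       (there (there x∈))  = _ , old (proj₂ (endpoint-edge es x∈))

  edge-orient : ∀ {es : Edges n} {x y} → Edge es x y → (x , y) ∈ es ⊎ (y , x) ∈ es
  edge-orient forth   = inj₁ (here refl)
  edge-orient back    = inj₂ (here refl)
  edge-orient (old e) = Sum.map there there (edge-orient e)

  ∈⇒edge : ∀ {es : Edges n} {x y} → (x , y) ∈ es → Edge es x y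
  ∈⇒edge (here refl) = forth
  ∈⇒edge (there e∈)  = old (∈⇒edge e∈)

  edge-within : ∀ {es : Edges n} {R : Rel (Fin n) 0ℓ} → (∀ {x y} → R x y → R y x) →
                All (uncurry R) es → ∀ {x y} → Edge es x y → R x y
  edge-within R-sym (r ∷ rs) forth   = r
  edge-within R-sym (r ∷ rs) back    = R-sym r
  edge-within R-sym (r ∷ rs) (old e) = edge-within R-sym rs e

-- Growing an interconnection tree part by part

module _ {n k} (G : MultipartiteGraph n k) where

  open MultipartiteGraph G

  -- A matching es projecting to a tree on the parts ps, grown by joining one
  -- new part at a time.  Each listed edge leads from an old part to a new one.
  data Growth : List (Fin k) → Edges n → Set where
    root : ∀ i → Growth (i ∷ []) []
    join : ∀ {ps es u v} → Growth ps es → part u ∈ ps → u ∉ endpoints es → part v ∉ ps →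
           Growth (part v ∷ ps) ((u , v) ∷ es)

  length-parts : ∀ {ps es} → Growth ps es → length ps ≡ suc (length es)
  length-parts (root i)       = refl
  length-parts (join g _ _ _) = cong suc (length-parts g)

  unique-parts : ∀ {ps es} → Growth ps es → Unique ps
  unique-parts (root i)        = [] ∷ []
  unique-parts (join g _ _ v∉) = ¬Any⇒All¬ _ v∉ ∷ unique-parts g

  some-part : ∀ {ps es} → Growth ps es → ∃ (_∈ ps)
  some-part (root i)       = i , here refl
  some-part (join _ _ _ _) = _ , here refl

  -- This makes `v` fresh in a `join`: its part is not in `ps`, so it cannot be an old endpoint.
  -- Only for `u` must freshness be demanded separately.
  endpoint-part : ∀ {ps es} → Growth ps es → ∀ {x} → x ∈ endpoints es → part x ∈ ps
  endpoint-part (join g u∈ _ _) (here refl)         = there u∈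
  endpoint-part (join g u∈ _ _) (there (here refl)) = here refl
  endpoint-part (join g u∈ _ _) (there (there x∈))  = there (endpoint-part g x∈)

  unique-endpoints : ∀ {ps es} → Growth ps es → Unique (endpoints es)
  unique-endpoints (root i) = []
  unique-endpoints (join g u∈ u∉ v∉) =
    ((λ { refl → v∉ u∈ }) ∷ ¬Any⇒All¬ _ u∉)
    ∷ ¬Any⇒All¬ _ (v∉ ∘ endpoint-part g)
    ∷ unique-endpoints g

  matching-edges : ∀ {ps es} → Growth ps es → IsMatching (Edge es)
  matching-edges (join g u∈ u∉ v∉) = λ where
    forth   forth   → refl
    forth   back    → contradiction u∈ v∉
    forth   (old e) → contradiction (edge-source e) u∉
    back    forth   → contradiction u∈ v∉
    back    back    → refl
    back    (old e) → contradiction (endpoint-part g (edge-source e)) v∉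
    (old e) forth   → contradiction (edge-source e) u∉
    (old e) back    → contradiction (endpoint-part g (edge-source e)) v∉
    (old d) (old e) → matching-edges g d e

  edge-crosses : ∀ {ps es} → Growth ps es → ∀ {x y} → Edge es x y → part x ≢ part y
  edge-crosses (join g u∈ _ v∉) forth   eq = v∉ (subst (_∈ _) eq u∈)
  edge-crosses (join g u∈ _ v∉) back    eq = v∉ (subst (_∈ _) (sym eq) u∈)
  edge-crosses (join g u∈ _ v∉) (old e) eq = edge-crosses g e eq

  -- Only the newest edge has an end in `part v`, so its projection agrees neither with that of an
  -- older edge nor with its own reversal.
  injective-edges : ∀ {ps es} → Growth ps es → ∀ {x y x′ y′} → Edge es x y → Edge es x′ y′ →
                    part x ≡ part x′ → part y ≡ part y′ → x ≡ x′ × y ≡ y′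
  injective-edges {es = (u , v) ∷ es} (join {ps = ps} g u∈ u∉ v∉) = injective
    where
    in-parts : ∀ {x y} → Edge es x y → part x ∈ ps × part y ∈ ps
    in-parts e = endpoint-part g (edge-source e) , endpoint-part g (edge-source (edge-sym e))

    new≢ : ∀ {w} → part w ∈ ps → part v ≢ part w
    new≢ w∈ eq = v∉ (subst (_∈ ps) (sym eq) w∈)

    injective : ∀ {x y x′ y′} → Edge ((u , v) ∷ es) x y → Edge ((u , v) ∷ es) x′ y′ →
                part x ≡ part x′ → part y ≡ part y′ → x ≡ x′ × y ≡ y′
    injective forth   forth   p q = refl , refl
    injective back    back    p q = refl , refl
    injective forth   back    p q = contradiction q (new≢ u∈)
    injective back    forth   p q = contradiction p (new≢ u∈)
    injective forth   (old e) p q = contradiction q (new≢ (proj₂ (in-parts e)))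
    injective back    (old e) p q = contradiction p (new≢ (proj₁ (in-parts e)))
    injective (old e) forth   p q = contradiction (sym q) (new≢ (proj₂ (in-parts e)))
    injective (old e) back    p q = contradiction (sym p) (new≢ (proj₁ (in-parts e)))
    injective (old d) (old e) p q = injective-edges g d e p q

  -- The parent relation on parts: the direction in which the edges were joined supplies the
  -- orientation required by `Rooted`.
  Up : Edges n → Rel (Fin k) 0ℓ
  Up es i j = ∃₂ λ u v → (u , v) ∈ es × part u ≡ i × part v ≡ j

  up-parts : ∀ {ps es} → Growth ps es → ∀ {u v} → (u , v) ∈ es → part u ∈ ps × part v ∈ ps
  up-parts g e∈ = endpoint-part g (edge-source (∈⇒edge e∈))
                , endpoint-part g (edge-source (edge-sym (∈⇒edge e∈)))

  -- A part other than the root enters `ps` together with a single listed edge, and all older edges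
  -- stay within the older parts.
  up-unique : ∀ {ps es} → Growth ps es → ∀ {i j x} → Up es i x → Up es j x → i ≡ j
  up-unique (join g _ _ _)  (_ , _ , here refl , refl , refl) (_ , _ , here refl , refl , _)  = refl
  up-unique (join g _ _ v∉) (_ , _ , here refl , refl , refl) (_ , _ , there e , refl , eq) =
    contradiction (subst (_∈ _) eq (proj₂ (up-parts g e))) v∉
  up-unique (join g _ _ v∉) (_ , _ , there e , refl , eq) (_ , _ , here refl , refl , refl) =
    contradiction (subst (_∈ _) eq (proj₂ (up-parts g e))) v∉
  up-unique (join g _ _ _)  (_ , _ , there d , p , q) (_ , _ , there e , p′ , q′) =
    up-unique g (_ , _ , d , p , q) (_ , _ , e , p′ , q′)

  -- The time of joining, counted from the end of the list: the root has rank 1, and 0 is the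
  -- default for parts not joined. Parents therefore have smaller rank than their children.
  rank : List (Fin k) → Fin k → ℕ
  rank []       i = 0
  rank (p ∷ ps) i with i Fin.≟ p
  ... | yes _ = suc (length ps)
  ... | no  _ = rank ps i

  rank-head : ∀ p ps → rank (p ∷ ps) p ≡ suc (length ps)
  rank-head p ps with p Fin.≟ p
  ... | yes _  = refl
  ... | no p≢p = contradiction refl p≢p

  rank-tail : ∀ {p ps i} → p ∉ ps → i ∈ ps → rank (p ∷ ps) i ≡ rank ps i
  rank-tail {p} {i = i} p∉ i∈ with i Fin.≟ p
  ... | yes refl = contradiction i∈ p∉
  ... | no _     = refl

  rank≤length : ∀ ps i → rank ps i ≤ length ps
  rank≤length []       i = z≤n
  rank≤length (p ∷ ps) i with i Fin.≟ p
  ... | yes _ = ≤-refl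
  ... | no  _ = m≤n⇒m≤1+n (rank≤length ps i)

  up-rank : ∀ {ps es} → Growth ps es → ∀ {i j} → Up es i j → rank ps i < rank ps j
  up-rank (join {ps} g u∈ _ v∉) (u , v , here refl , refl , refl)
    rewrite rank-head (part v) ps | rank-tail v∉ u∈ = s≤s (rank≤length ps (part u))
  up-rank (join g _ _ v∉) (u , v , there e , refl , refl)
    with u∈ , v∈ ← up-parts g e
    rewrite rank-tail v∉ u∈ | rank-tail v∉ v∈ = up-rank g (u , v , e , refl , refl)

  acyclic-edges : ∀ {ps es} → Growth ps es → Acyclic (Image (Edge es))
  acyclic-edges {ps} {es} g =
    Rooted.acyclic {Up = Up es} (rank ps) orient (up-rank g) (up-unique g)
    where
    orient : ∀ {i j} → Image (Edge es) i j → Up es i j ⊎ Up es j i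
    orient (image e) = Sum.map (λ e∈ → _ , _ , e∈ , refl , refl) (λ e∈ → _ , _ , e∈ , refl , refl)
                               (edge-orient e)

  connected-edges : ∀ {ps es} → Growth ps es →
                    ∀ {i j} → i ∈ ps → j ∈ ps → Star (Image (Edge es)) i j
  connected-edges (root i) (here refl) (here refl) = ε
  connected-edges {es = (u , v) ∷ es} (join {ps = ps} g u∈ u∉ v∉) = connected
    where
    older : ∀ {i j} → i ∈ ps → j ∈ ps → Star (Image (Edge ((u , v) ∷ es))) i j
    older i∈ j∈ = Star.map (λ { (image e) → image (old e) }) (connected-edges g i∈ j∈)

    connected : ∀ {i j} → i ∈ part v ∷ ps → j ∈ part v ∷ ps →
                Star (Image (Edge ((u , v) ∷ es))) i j
    connected (here refl) (here refl) = ε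
    connected (here refl) (there j∈)  = image back ◅ older u∈ j∈
    connected (there i∈)  (here refl) = older i∈ u∈ ◅◅ image forth ◅ ε
    connected (there i∈)  (there j∈)  = older i∈ j∈

  full⇒tree : IsComplete G → ∀ {ps es} → Growth ps es → (∀ i → i ∈ ps) → InterconnectionTree G
  full⇒tree complete {ps} {es} g full = record
    { T            = Edge es
    ; T?           = edge? es
    ; T-sym        = edge-sym
    ; T⊆E          = edge⊆adj
    ; matching     = matching-edges g
    ; spanningTree = record
      { subset    = λ { (image e) → image (edge⊆adj e) }
      ; symmetric = image-sym edge-sym
      ; connected = λ i j → connected-edges g (full i) (full j)
      ; acyclic   = acyclic-edges g
      }
    ; injective    = injective-edges g
    }
    where
    edge⊆adj : ∀ {x y} → Edge es x y → Adj x y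
    edge⊆adj e = complete _ _ (edge-crosses g e)

  tree-parts : ∀ {ps es} → Growth ps es → length ps ≡ k → ∀ i → i ∈ ps
  tree-parts {ps} g full i = decidable-stable (i ∈? ps) λ i∉ →
    <-irrefl full (unique⇒length≤ (¬Any⇒All¬ _ i∉ ∷ unique-parts g))

  -- Necessity of the bound

  first-part : Fin k
  first-part = fromℕ< k≥1

  module _ {T : Rel (Fin n) 0ℓ} (T-sym : ∀ {x y} → T x y → T y x)
           (matching : IsMatching T) (connected : Connected (Image T)) where

    -- Follow the walk up to its first step out of `ps`.
    crossing : ∀ {ps i j} → Star (Image T) i j → i ∈ ps → j ∉ ps →
               ∃₂ λ u v → T u v × part u ∈ ps × part v ∉ ps
    crossing ε i∈ j∉ = contradiction i∈ j∉
    crossing {ps} (image {u} {v} t ◅ walk) i∈ j∉ with part v ∈? ps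
    ... | yes v∈ = crossing walk v∈ j∉
    ... | no  v∉ = u , v , t , i∈ , v∉

    -- Lists edges of the relation `T` as a `Growth`, so that their endpoints can be counted.
    -- Connectedness yields an edge of `T` leaving the joined parts at every stage; `d` is the
    -- number of parts still missing.
    grow-within : ∀ d {ps es} → Growth ps es → All (uncurry T) es → length ps + d ≡ k →
                  ∃₂ λ ps′ es′ → Growth ps′ es′ × length ps′ ≡ k
    grow-within zero    g ts eq = _ , _ , g , trans (sym (+-identityʳ _)) eq
    grow-within (suc d) {ps} {es} g ts eq
      with i , i∈ ← some-part g
      with j , j∉ ← ∃-outside ps (subst (length ps <_) eq (m<m+n (length ps) z<s))
      with u , v , t , u∈ , v∉ ← crossing (connected i j) i∈ j∉
      = grow-within d (join g u∈ u∉ v∉) (t ∷ ts) (trans (sym (+-suc (length ps) d)) eq)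
      where
      -- An endpoint is already matched along es, hence not to the new v.
      u∉ : u ∉ endpoints es
      u∉ u∈ with w , e ← endpoint-edge es u∈ with refl ← matching t (edge-within T-sym ts e) =
        v∉ (endpoint-part g (edge-source (edge-sym e)))

  length-edges : ∀ {ps es} → Growth ps es → length ps ≡ k → length es ≡ pred k
  length-edges g full = cong pred (trans (sym (length-parts g)) full)

  tree⇒bound : InterconnectionTree G → pred k + pred k ≤ n
  tree⇒bound record { T-sym = T-sym ; matching = matching ; spanningTree = spanning }
    -- One part serves as the root, which leaves `pred k` parts to join.
    with ps , es , g , full ← grow-within T-sym matching (IsSpanningTree.connected spanning) (pred k) (root first-part) []
                                (suc-pred k {{>-nonZero k≥1}})
    = subst (_≤ n) (trans (length-endpoints es) (cong₂ _+_ (length-edges g full) (length-edges g full)))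
        (unique⇒length≤ (unique-endpoints g))

  -- Sufficiency of the bound

  Free : List (Fin k) → Edges n → Set
  Free ps es = ∃ λ u → part u ∈ ps × u ∉ endpoints es

  SingletonsOutside : List (Fin k) → Set
  SingletonsOutside ps = ∀ {u v} → part u ∉ ps → part u ≡ part v → u ≡ v

  outside : List (Fin k) → List (Fin n)
  outside ps = filter (λ v → ¬? (part v ∈? ps)) (allFin n)

  -- Outside `ps` every vertex has its part to itself, so the parts of these vertices are distinct;
  -- they also differ from those in `ps`, and there are only `k` parts.
  length-outside : ∀ {ps es} → Growth ps es → SingletonsOutside ps →
                   length ps + length (outside ps) ≤ k
  length-outside {ps} g single = begin
    length ps + length (outside ps)            ≡⟨ cong (length ps +_) (length-map part (outside ps)) ⟨
    length ps + length (map part (outside ps)) ≡⟨ length-++ ps ⟨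
    length (ps ++ map part (outside ps))       ≤⟨ unique⇒length≤ unique ⟩
    k                                          ∎
    where
    open ≤-Reasoning

    outside-∉ : All (λ v → part v ∉ ps) (outside ps)
    outside-∉ = All.tabulate (λ v∈ → proj₂ (∈-filter⁻ (λ v → ¬? (part v ∈? ps)) {xs = allFin n} v∈))

    unique-map : ∀ {vs} → All (λ v → part v ∉ ps) vs → Unique vs → Unique (map part vs)
    unique-map []        []         = []
    unique-map (v∉ ∷ ∉s) (v≢ ∷ u) =
      map⁺ (All.map (λ v≢w eq → v≢w (single v∉ eq)) v≢) ∷ unique-map ∉s u

    unique : Unique (ps ++ map part (outside ps))
    unique = Unique.++⁺ (unique-parts g)
      (unique-map outside-∉ (Unique.filter⁺ _ (allFin⁺ n)))
      λ { (i∈ , i∈map) → let v , v∈ , eq = ∈-map⁻ part i∈map in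
          All.lookup outside-∉ v∈ (subst (_∈ ps) eq i∈) }

  -- If all vertices of the joined parts were matched, there would be at most
  -- 2e + (k - 1 - e) < 2(k - 1) vertices in total, where e = length es.
  singletons⇒free : pred k + pred k ≤ n → ∀ {ps es} → Growth ps es → length ps < k →
                    SingletonsOutside ps → Free ps es
  singletons⇒free bound {ps} {es} g short single
    with any? (λ u → part u ∈? ps ×-dec ¬? (u ∈? endpoints es))
  ... | yes free = free
  ... | no  none = contradiction bound (<⇒≱ (begin-strict
    n                                           ≤⟨ exhaustive⇒≤length covered ⟩
    length (endpoints es ++ outside ps)         ≡⟨ length-++ (endpoints es) ⟩
    length (endpoints es) + length (outside ps) ≡⟨ cong (_+ length (outside ps)) (length-endpoints es) ⟩
    (e + e) + length (outside ps)               ≡⟨ +-assoc e e _ ⟩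
    e + (e + length (outside ps))               ≤⟨ +-monoʳ-≤ e rest ⟩
    e + pred k                                  <⟨ +-monoˡ-< (pred k) e<k-1 ⟩
    pred k + pred k                             ∎))
    where
    open ≤-Reasoning

    e = length es

    -- There is one part more than there are edges, hence the predecessor of `k`.
    rest : e + length (outside ps) ≤ pred k
    rest = pred-mono-≤ (subst (λ l → l + length (outside ps) ≤ k) (length-parts g)
                              (length-outside g single))

    e<k-1 : e < pred k
    e<k-1 = pred-mono-≤ (subst (_< k) (length-parts g) short)

    -- Without a free vertex, every vertex of a joined part is an endpoint; all others are outside.
    covered : ∀ v → v ∈ endpoints es ++ outside ps
    covered v with part v ∈? ps
    ... | no  v∉ = ∈-++⁺ʳ (endpoints es) (∈-filter⁺ _ (∈-allFin v) v∉)
    ... | yes v∈ = ∈-++⁺ˡ (decidable-stable (v ∈? endpoints es) (λ v∉ → none (v , v∈ , v∉)))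

  -- Joining a part of size at least two leaves one of its vertices free, so
  -- such parts are joined first.
  grow : pred k + pred k ≤ n → ∀ d {ps es} → Growth ps es → length ps + d ≡ k →
         Free ps es ⊎ SingletonsOutside ps → ∃₂ λ ps′ es′ → Growth ps′ es′ × length ps′ ≡ k
  grow bound zero    g eq _ = _ , _ , g , trans (sym (+-identityʳ _)) eq
  grow bound (suc d) {ps} {es} g eq state
    with any? (λ v → any? (λ v′ → ¬? (part v ∈? ps) ×-dec part v Fin.≟ part v′ ×-dec ¬? (v Fin.≟ v′)))
  ... | yes (v , v′ , v∉ , same , v≢v′) = grow-large state
    where
    grow-large : Free ps es ⊎ SingletonsOutside ps → ∃₂ λ ps′ es′ → Growth ps′ es′ × length ps′ ≡ k
    grow-large (inj₂ single)        = contradiction (single v∉ same) v≢v′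
    -- The edge from `u` uses up `v`, and `v′` in the same part becomes the free vertex of the next
    -- stage: it differs from `v`, and its part is new.
    grow-large (inj₁ (u , u∈ , u∉)) =
      grow bound d (join g u∈ u∉ v∉) (trans (sym (+-suc (length ps) d)) eq)
           (inj₁ (v′ , here (sym same) , λ where
             (here refl)         → v∉ (subst (_∈ ps) (sym same) u∈)
             (there (here refl)) → v≢v′ refl
             (there (there v′∈)) → v∉ (subst (_∈ ps) (sym same) (endpoint-part g v′∈))))
  -- All remaining parts are singletons and stay so, whichever alternative `state` was; the free
  -- vertex now comes from counting.
  ... | no  none =
    let j , j∉      = ∃-outside ps short
        v , v-in-j  = nonEmpty j
        u , u∈ , u∉ = singletons⇒free bound g short single
    in grow bound d (join g u∈ u∉ (subst (_∉ ps) (sym v-in-j) j∉)) (trans (sym (+-suc (length ps) d)) eq)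
            (inj₂ (λ x∉ → single (x∉ ∘ there)))
    where
    short : length ps < k
    short = subst (length ps <_) eq (m<m+n (length ps) z<s)

    single : SingletonsOutside ps
    single {x} {y} x∉ same = decidable-stable (x Fin.≟ y) λ x≢y → none (x , y , x∉ , same , x≢y)

  bound⇒tree : IsComplete G → pred k + pred k ≤ n → InterconnectionTree G
  bound⇒tree complete bound
    -- Before any edge is chosen, each vertex of the root part is free.
    with v , v-in-first ← nonEmpty first-part
    with ps , es , g , full ← grow bound (pred k) (root first-part) (suc-pred k {{>-nonZero k≥1}})
                                (inj₁ (v , here v-in-first , λ ()))
    = full⇒tree complete g (tree-parts g full)

-- The program and the layout of its input

-- Since all parts are non-empty, k - 1 is the maximum of Part.
program : Program
program
  = load 0 5         --  0  n := mem[0], register 5 being zero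
  ∷ const 3 1        --  1
  ∷ add 1 1 3        --  2  i := i + 1
  ∷ load 4 1         --  3
  ∷ jlt 4 2 6        --  4  skip the update unless mem[i] is at least the maximum
  ∷ add 2 4 5        --  5
  ∷ jlt 1 0 2        --  6  loop while i < n
  ∷ add 2 2 2        --  7
  ∷ jlt 0 2 10       --  8
  ∷ accept           --  9
  ∷ reject           -- 10
  ∷ []

‼-tabulate : {A : Set} {n : ℕ} (f : Fin n → A) (ys : List A) (v : Fin n) →
             (tabulate f ++ ys) ‼ toℕ v ≡ just (f v)
‼-tabulate f ys Fin.zero    = refl
‼-tabulate f ys (Fin.suc v) = ‼-tabulate (f ∘ Fin.suc) ys v

‼-map-allFin : {A : Set} {n : ℕ} (f : Fin n → A) (ys : List A) (v : Fin n) →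
               (map f (allFin n) ++ ys) ‼ toℕ v ≡ just (f v)
‼-map-allFin f ys v =
  trans (cong (λ xs → (xs ++ ys) ‼ toℕ v) (map-tabulate id f)) (‼-tabulate f ys v)

length-cartesianProductWith : {A B C : Set} (f : A → B → C) (xs : List A) (ys : List B) →
                              length (cartesianProductWith f xs ys) ≡ length xs * length ys
length-cartesianProductWith f []       ys = refl
length-cartesianProductWith f (x ∷ xs) ys = trans (length-++ (map (f x) ys))
  (cong₂ _+_ (length-map (f x) ys) (length-cartesianProductWith f xs ys))

wrap-small : ∀ w {x} → x < 2 ^ w → wrap w x ≡ x
wrap-small w = m<n⇒m%n≡m {{m^n≢0 2 w}}

<ᵇ-true : ∀ {m n} → m < n → (m <ᵇ n) ≡ true
<ᵇ-true {m} {n} = dec-true (m <? n)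

<ᵇ-false : ∀ {m n} → n ≤ m → (m <ᵇ n) ≡ false
<ᵇ-false {m} {n} n≤m = dec-false (m <? n) (≤⇒≯ n≤m)

-- Correctness and running time of the program

module _ {n k} (G : MultipartiteGraph n k) (w : ℕ) (fits : length (encode G) ≤ 2 ^ w) where

  open MultipartiteGraph G

  private
    memory : ℕ → ℕ
    memory = State.mem (initial (encode G))

  memory-part : ∀ v → memory (suc (toℕ v)) ≡ toℕ (part v)
  memory-part v = cong (fromMaybe 0) (‼-map-allFin (toℕ ∘ part) _ v)

  -- Choosing a vertex from each part is injective.
  k≤n : k ≤ n
  k≤n = injective⇒≤ {f = proj₁ ∘ nonEmpty} λ {i} {j} eq →
    trans (sym (proj₂ (nonEmpty i))) (trans (cong part eq) (proj₂ (nonEmpty j)))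

  n≥1 : 1 ≤ n
  n≥1 = ≤-trans k≥1 k≤n

  length-encode : length (encode G) ≡ suc (n + n * n)
  length-encode = cong suc (trans (length-++ (map (toℕ ∘ part) (allFin n)))
    (cong₂ _+_ (trans (length-map (toℕ ∘ part) (allFin n)) (length-allFin {n}))
               (trans (length-cartesianProductWith _ (allFin n) (allFin n))
                      (cong₂ _*_ (length-allFin {n}) (length-allFin {n})))))

  -- The input has length `1 + n + n * n`, which exceeds `n + n` since `n ≥ 1`. This keeps the
  -- doubling in the program from overflowing.
  n+n<2^w : n + n < 2 ^ w
  n+n<2^w = ≤-trans (s≤s (+-monoʳ-≤ n (m≤m*n n n {{>-nonZero n≥1}})))
                    (subst (_≤ 2 ^ w) length-encode fits)

  n<2^w : n < 2 ^ w
  n<2^w = ≤-<-trans (m≤m+n n n) n+n<2^w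

  -- The loop invariant after `i` entries of `Part` have been read. Instead of saying that the
  -- maximum `m` is attained, it keeps `m < k`, which suffices to determine `m` at the end. Register
  -- 5 stays zero so that adding it copies a register.
  record Scanned (i m : ℕ) (R : ℕ → ℕ) : Set where
    field
      r0 : R 0 ≡ n
      r1 : R 1 ≡ i
      r2 : R 2 ≡ m
      r3 : R 3 ≡ 1
      r5 : R 5 ≡ 0
      bound : ∀ v → toℕ v < i → toℕ (part v) ≤ m
      m<k   : m < k

  answer : Bool
  answer = not (n <ᵇ pred k + pred k)

  pred<k : pred k < k
  pred<k = ≤-reflexive (suc-pred k {{>-nonZero k≥1}})

  -- The part with the last index is non-empty, so its index has been read and `m` is at least
  -- `pred k`; the other inequality is `m < k`.
  scanned-all : ∀ {m R} → Scanned n m R → m ≡ pred k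
  scanned-all {m} s with v , eq ← nonEmpty (fromℕ< pred<k)
    = ≤-antisym (pred-mono-≤ (Scanned.m<k s))
        (subst (_≤ m) (trans (cong toℕ eq) (toℕ-fromℕ< pred<k)) (Scanned.bound s v (toℕ<n v)))

  -- Three steps remain: the doubling, the comparison and the verdict.
  decide : ∀ t {m R} → Scanned n m R → run w program (3 + t) ⟨ 7 , R , memory ⟩ ≡ just answer
  decide t {m} {R} s with refl ← scanned-all s = by-comparison (n <? pred k + pred k)
    where
    open Scanned s
    doubled : wrap w (R 2 + R 2) ≡ pred k + pred k
    doubled rewrite r2 = wrap-small w (≤-<-trans (+-mono-≤ k-1≤n k-1≤n) n+n<2^w)
      where k-1≤n = ≤-trans pred[n]≤n k≤n
    by-comparison : Dec (n < pred k + pred k) →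
                    run w program (3 + t) ⟨ 7 , R , memory ⟩ ≡ just answer
    by-comparison (yes lt) rewrite doubled | r0 | <ᵇ-true lt = refl
    by-comparison (no ge)  rewrite doubled | r0 | <ᵇ-false (≮⇒≥ ge) = refl

  mutual

    -- With `suc d` entries unread, each costs at most five instructions, and `decide` takes three
    -- more.
    loop : ∀ d t {i m R} → i + suc d ≡ n → Scanned i m R → 5 * suc d + 3 ≤ t →
           run w program t ⟨ 2 , R , memory ⟩ ≡ just answer
    loop d t {i} {m} {R} eq s enough = iterate t (subst (λ b → b + 3 ≤ t) (*-suc 5 d) enough)
      where
      open Scanned s

      i<n : i < n
      i<n = subst (i <_) eq (m<m+n i z<s)

      current : Fin n
      current = fromℕ< i<n

      p : ℕ
      p = toℕ (part current)

      next : wrap w (R 1 + R 3) ≡ suc i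
      next rewrite r1 | r3 | +-comm i 1 = wrap-small w (≤-<-trans i<n n<2^w)

      -- Address 0 holds `n`, so the entry of vertex `i` lies at `suc i`; this is why the counter is
      -- incremented before the load.
      entry : memory (wrap w (R 1 + R 3)) ≡ p
      entry = trans (cong memory (trans next (cong suc (sym (toℕ-fromℕ< i<n))))) (memory-part current)

      loaded : ℕ → ℕ
      loaded = (R [ 1 ↦ wrap w (R 1 + R 3) ]) [ 4 ↦ memory (wrap w (R 1 + R 3)) ]

      copied : wrap w (loaded 4 + loaded 5) ≡ p
      copied rewrite entry | r5 | +-identityʳ p =
        wrap-small w (<-trans (<-≤-trans (toℕ<n (part current)) k≤n) n<2^w)

      extend : ∀ {m′} → m ≤ m′ → p ≤ m′ → ∀ v → toℕ v < suc i → toℕ (part v) ≤ m′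
      extend m≤m′ p≤m′ v v≤i with toℕ v ≟ i
      ... | no  v≢i = ≤-trans (bound v (≤∧≢⇒< (s≤s⁻¹ v≤i) v≢i)) m≤m′
      ... | yes v≡i rewrite toℕ-injective (trans v≡i (sym (toℕ-fromℕ< i<n))) = p≤m′

      eq′ : suc i + d ≡ n
      eq′ = trans (sym (+-suc i d)) eq

      iterate : ∀ t → 5 + 5 * d + 3 ≤ t → run w program t ⟨ 2 , R , memory ⟩ ≡ just answer
      iterate (suc (suc (suc (suc t)))) (s≤s (s≤s (s≤s (s≤s enough)))) with p <? m
      -- Skipping the update saves one step of the budget.
      ... | yes p<m rewrite trans (cong₂ _<ᵇ_ entry r2) (<ᵇ-true p<m) =
        continue d (suc t) eq′ record
          { r0 = r0 ; r1 = next ; r2 = r2 ; r3 = r3 ; r5 = r5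
          ; bound = extend ≤-refl (<⇒≤ p<m) ; m<k = m<k }
          (m≤n⇒m≤1+n enough)
      ... | no  p≮m rewrite trans (cong₂ _<ᵇ_ entry r2) (<ᵇ-false (≮⇒≥ p≮m)) =
        continue d t eq′ record
          { r0 = r0 ; r1 = next ; r2 = copied ; r3 = r3 ; r5 = r5
          ; bound = extend (≮⇒≥ p≮m) ≤-refl ; m<k = toℕ<n (part current) }
          enough

    -- The loop test accounts for the one extra step; it exits exactly when no entry is left, that
    -- is, for `d` zero.
    continue : ∀ d t {i m R} → i + d ≡ n → Scanned i m R → suc (5 * d + 3) ≤ t →
               run w program t ⟨ 6 , R , memory ⟩ ≡ just answer
    continue zero (suc (suc (suc (suc t)))) {i} eq s (s≤s (s≤s (s≤s (s≤s _))))
      with refl ← trans (sym (+-identityʳ i)) eq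
      rewrite trans (cong₂ _<ᵇ_ (Scanned.r1 s) (Scanned.r0 s)) (<ᵇ-false {i} ≤-refl) = decide t s
    continue (suc d) (suc t) {i} eq s (s≤s enough)
      rewrite trans (cong₂ _<ᵇ_ (Scanned.r1 s) (Scanned.r0 s))
                    (<ᵇ-true (subst (i <_) eq (m<m+n i z<s))) = loop d t eq s enough

  program-decides : run w program (10 * n) (initial (encode G)) ≡ just answer
  program-decides = start (10 * n) enough
    where
    registers : ℕ → ℕ
    registers = ((λ _ → 0) [ 0 ↦ n ]) [ 3 ↦ wrap w 1 ]

    scanned : Scanned 0 0 registers
    scanned = record
      { r0 = refl ; r1 = refl ; r2 = refl
      ; r3 = wrap-small w (≤-<-trans n≥1 n<2^w)
      ; r5 = refl ; bound = λ _ () ; m<k = k≥1 }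

    -- Two steps of setup, five per vertex and three for the decision make `5 + 5 * n`, which is at
    -- most `10 * n` because `n ≥ 1`.
    enough : 2 + (5 * suc (pred n) + 3) ≤ 10 * n
    enough = begin
      2 + (5 * suc (pred n) + 3) ≡⟨ cong (λ l → 2 + (5 * l + 3)) (suc-pred n {{>-nonZero n≥1}}) ⟩
      2 + (5 * n + 3)            ≡⟨ cong (2 +_) (+-comm (5 * n) 3) ⟩
      5 + 5 * n                  ≤⟨ +-monoˡ-≤ (5 * n) (*-monoʳ-≤ 5 n≥1) ⟩
      5 * n + 5 * n              ≡⟨ *-distribʳ-+ n 5 5 ⟨
      10 * n                     ∎
      where open ≤-Reasoning

    start : ∀ t → 2 + (5 * suc (pred n) + 3) ≤ t → run w program t (initial (encode G)) ≡ just answer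
    start (suc (suc t)) (s≤s (s≤s enough)) =
      -- The loop body precedes its test, so a first entry must exist; it does since `n ≥ 1`.
      loop (pred n) t (suc-pred n {{>-nonZero n≥1}}) scanned enough

  answer-correct : IsComplete G → Reflects (ITP G) answer
  answer-correct complete = by-comparison (n <? pred k + pred k)
    where
    by-comparison : Dec (n < pred k + pred k) → Reflects (ITP G) answer
    by-comparison (yes lt) rewrite <ᵇ-true lt        = ofⁿ λ tree → <⇒≱ lt (tree⇒bound G tree)
    by-comparison (no ge)  rewrite <ᵇ-false (≮⇒≥ ge) = ofʸ (bound⇒tree G complete (≮⇒≥ ge))

corollary10 : SolvableInTimeO (λ n → n) ITP IsComplete
corollary10 = program , 10 , λ G complete w fits →
  answer G w fits , program-decides G w fits , answer-correct G w fits complete
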